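{- Let $T$ be an h-inductive theory in a first-order language $L$ and let $A$ be a model of $T$. Then $A$ is an amalgamation basis of $T$ if and only if it satisfies the following property: for every positive formula $\phi(\bar x)$ and every tuple $\bar a$ of $A$ (of the length of $\bar x$), if $A\not\models\phi(\bar a)$, then there exist $\phi'\in Res_T(\phi)$ and a family $(\varphi_\psi)_{\psi\in Res_T(\phi)}$ of positive formulas with $\varphi_\psi\in Res_T(\psi)$ for every $\psi\in Res_T(\phi)$, such that $$A\models\phi'(\bar a)\vee\bigwedge_{\psi\in Res_T(\phi)}\varphi_\psi(\bar a),$$ i.e. either $A\models\phi'(\bar a)$, or $A\models\varphi_\psi(\bar a)$ for all $\psi\in Res_T(\phi)$ (the conjunction may be infinite).
   Context: Let $L$ be a first-order language with equality. A positive formula is one obtained from atomic formulas (including falsity $\bot$) using $\exists,\vee,\wedge$. An h-inductive sentence is a finite conjunction of sentences $\forall\bar x(\exists\bar y\,\varphi(\bar x,\bar y)\rightarrow\exists\bar z\,\psi(\bar x,\bar z))$ with $\varphi,\psi$ quantifier-free positive. An h-inductive theory is a theory axiomatized by h-inductive sentences. A homomorphism $f:A\to B$ of $L$-structures is a map such that $A\models\phi(\bar a)$ implies $B\models\phi(f(\bar a))$ for every atomic $\phi$ and tuple $\bar a$ of $A$. A model $A$ of $T$ is an amalgamation basis of $T$ if for all models $B,C$ of $T$ and homomorphisms $f:A\to B$, $g:A\to C$ there are a model $D$ of $T$ and homomorphisms $g':B\to D$, $f':C\to D$ with $g'\circ f=f'\circ g$. For a positive formula $\phi(\bar x)$, $Res_T(\phi)$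 is the set of positive formulas $\psi(\bar x)$ (in the same free variables) such that $T\vdash\neg\exists\bar x(\phi(\bar x)\wedge\psi(\bar x))$. -}

module Defs where

open import Data.Fin.Base using (Fin)
open import Data.Nat.Base using (ℕ; zero; suc; _+_)
open import Data.Product.Base using (Σ-syntax; ∃-syntax; _×_; _,_)
open import Data.Sum.Base using (_⊎_)
import Data.Empty.Polymorphic as Empty
open import Data.Vec.Functional using (Vector; _∷_; [])
open import Data.Vec.Functional.Relation.Binary.Pointwise using (Pointwise)
open import Function.Base using (_∘_)
open import Level using (Level) renaming (suc to lsuc)
open import Relation.Binary.Bundles using (Setoid)
open import Relation.Nullary.Negation.Core using (¬_)
open import Relation.Unary using (Pred; _∈_)

record Language (ℓ : Level) : Set (lsuc ℓ) where
  field
    Fun : ℕ → Set ℓ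
    Rel : ℕ → Set ℓ

module _ {ℓ : Level} (L : Language ℓ) where
  open Language L

  data Term (n : ℕ) : Set ℓ where
    var : Fin n → Term n
    app : ∀ {k} → Fun k → Vector (Term n) k → Term n

  infix  8 _≐_
  infixr 7 _∧_
  infixr 6 _∨_
  infixr 5 _⇒_

  -- Formula n: first-order formulas with free variables among n de Bruijn
  -- variables; the variable bound by a quantifier has index zero.
  data Formula (n : ℕ) : Set ℓ where
    ⊥           : Formula n
    _≐_         : Term n → Term n → Formula n
    rel         : ∀ {k} → Rel k → Vector (Term n) k → Formula n
    _∧_ _∨_ _⇒_ : Formula n → Formula n → Formula n
    ∃′ ∀′       : Formula (suc n) → Formula n

  Sentence : Set ℓ
  Sentence = Formula 0

  Theory : Set (lsuc ℓ)
  Theory = Pred Sentence ℓ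

module _ {ℓ : Level} {L : Language ℓ} where
  open Language L

  ¬′_ : ∀ {n} → Formula L n → Formula L n
  ¬′ φ = φ ⇒ ⊥

  -- Quantification over the first k variables, leaving m free.
  ∃^ : ∀ {m} k → Formula L (k + m) → Formula L m
  ∃^ zero    φ = φ
  ∃^ (suc k) φ = ∃^ k (∃′ φ)

  -- Quantification over all free variables.
  ∃* : ∀ {n} → Formula L n → Sentence L
  ∃* {zero}  φ = φ
  ∃* {suc n} φ = ∃* (∃′ φ)

  ∀* : ∀ {n} → Formula L n → Sentence L
  ∀* {zero}  φ = φ
  ∀* {suc n} φ = ∀* (∀′ φ)

  data Atomic {n : ℕ} : Formula L n → Set ℓ where
    ⊥   : Atomic ⊥
    _≐_ : ∀ t u → Atomic (t ≐ u)
    rel : ∀ {k} (R : Rel k) ts → Atomic (rel R ts)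

  data Positive {n : ℕ} : Formula L n → Set ℓ where
    atomic : ∀ {φ} → Atomic φ → Positive φ
    _∧_    : ∀ {φ ψ} → Positive φ → Positive ψ → Positive (φ ∧ ψ)
    _∨_    : ∀ {φ ψ} → Positive φ → Positive ψ → Positive (φ ∨ ψ)
    ∃′     : ∀ {φ} → Positive φ → Positive (∃′ φ)

  data QFPositive {n : ℕ} : Formula L n → Set ℓ where
    atomic : ∀ {φ} → Atomic φ → QFPositive φ
    _∧_    : ∀ {φ ψ} → QFPositive φ → QFPositive ψ → QFPositive (φ ∧ ψ)
    _∨_    : ∀ {φ ψ} → QFPositive φ → QFPositive ψ → QFPositive (φ ∨ ψ)

  data HInductive : Sentence L → Set ℓ where
    basic : ∀ {n k l} {φ : Formula L (k + n)} {ψ : Formula L (l + n)} →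
            QFPositive φ → QFPositive ψ →
            HInductive (∀* {n} (∃^ k φ ⇒ ∃^ l ψ))
    _∧_   : ∀ {σ τ} → HInductive σ → HInductive τ → HInductive (σ ∧ τ)

-- Structures are setoid-based: _≈_ interprets the equality symbol, so a
-- structure stands for the quotient of its carrier by _≈_. Structures are
-- nonempty, as usual in first-order logic.
record Structure {ℓ : Level} (L : Language ℓ) : Set (lsuc ℓ) where
  open Language L
  field
    setoid : Setoid ℓ ℓ
  open Setoid setoid public
  field
    inhabitant : Carrier
    fun        : ∀ {k} → Fun k → Vector Carrier k → Carrier
    fun-cong   : ∀ {k} (f : Fun k) {xs ys} →
                 Pointwise _≈_ xs ys → fun f xs ≈ fun f ys
    holds      : ∀ {k} → Rel k → Vector Carrier k → Set ℓ
    holds-resp : ∀ {k} (R : Rel k) {xs ys} →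
                 Pointwise _≈_ xs ys → holds R xs → holds R ys

∣_∣ : ∀ {ℓ} {L : Language ℓ} → Structure L → Set ℓ
∣ A ∣ = Structure.Carrier A

module _ {ℓ : Level} {L : Language ℓ} where

  ⟦_⟧ : ∀ {n} → Term L n → (A : Structure L) → Vector ∣ A ∣ n → ∣ A ∣
  ⟦ var i    ⟧ A a = a i
  ⟦ app f ts ⟧ A a = Structure.fun A f (λ i → ⟦ ts i ⟧ A a)

  infix 4 _⊨_[_] _⊨_ _⊢_

  _⊨_[_] : ∀ {n} (A : Structure L) → Formula L n → Vector ∣ A ∣ n → Set ℓ
  A ⊨ ⊥        [ a ] = Empty.⊥
  A ⊨ t ≐ u    [ a ] = Structure._≈_ A (⟦ t ⟧ A a) (⟦ u ⟧ A a)
  A ⊨ rel R ts [ a ] = Structure.holds A R (λ i → ⟦ ts i ⟧ A a)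
  A ⊨ φ ∧ ψ    [ a ] = A ⊨ φ [ a ] × A ⊨ ψ [ a ]
  A ⊨ φ ∨ ψ    [ a ] = A ⊨ φ [ a ] ⊎ A ⊨ ψ [ a ]
  A ⊨ φ ⇒ ψ    [ a ] = A ⊨ φ [ a ] → A ⊨ ψ [ a ]
  A ⊨ ∃′ φ     [ a ] = Σ[ x ∈ ∣ A ∣ ] A ⊨ φ [ x ∷ a ]
  A ⊨ ∀′ φ     [ a ] = (x : ∣ A ∣) → A ⊨ φ [ x ∷ a ]

  _⊨_ : Structure L → Sentence L → Set ℓ
  A ⊨ σ = A ⊨ σ [ [] ]

  Model : Theory L → Set (lsuc ℓ)
  Model T = Σ[ A ∈ Structure L ] (∀ σ → σ ∈ T → A ⊨ σ)

  -- Consequence: truth in every model.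
  _⊢_ : Theory L → Sentence L → Set (lsuc ℓ)
  T ⊢ σ = ((A , _) : Model T) → A ⊨ σ

  -- T need not consist of h-inductive sentences itself: it has the same
  -- consequences as some set of them.
  HInductiveTheory : Theory L → Set (lsuc ℓ)
  HInductiveTheory T =
    Σ[ Ax ∈ Theory L ]
      (∀ σ → σ ∈ Ax → HInductive σ) ×
      (∀ σ → σ ∈ Ax → T ⊢ σ) ×
      (∀ σ → σ ∈ T → Ax ⊢ σ)

  record Hom (A B : Structure L) : Set ℓ where
    field
      map       : ∣ A ∣ → ∣ B ∣
      preserves : ∀ {n} {φ : Formula L n} → Atomic φ →
                  ∀ a → A ⊨ φ [ a ] → B ⊨ φ [ map ∘ a ]

  AmalgamationBasis : (T : Theory L) → Model T → Set (lsuc ℓ)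
  AmalgamationBasis T (A , _) =
    ((B , _) (C , _) : Model T) (f : Hom A B) (g : Hom A C) →
    Σ[ (D , _) ∈ Model T ] Σ[ g′ ∈ Hom B D ] Σ[ f′ ∈ Hom C D ]
      (∀ x → Structure._≈_ D (Hom.map g′ (Hom.map f x))
                             (Hom.map f′ (Hom.map g x)))

  Res : ∀ {n} → Theory L → Formula L n → Pred (Formula L n) (lsuc ℓ)
  Res T φ ψ = Positive ψ × (T ⊢ ¬′ ∃* (φ ∧ ψ))

  ResolventProperty : (T : Theory L) → Structure L → Set (lsuc ℓ)
  ResolventProperty T A =
    ∀ {n} (φ : Formula L n) → Positive φ →
    (a : Vector ∣ A ∣ n) → ¬ (A ⊨ φ [ a ]) →
    ∃[ φ′ ] φ′ ∈ Res T φ ×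
    Σ[ χ ∈ (∀ ψ → ψ ∈ Res T φ → Formula L n) ]
      (∀ ψ (r : ψ ∈ Res T φ) → χ ψ r ∈ Res T ψ) ×
      (A ⊨ φ′ [ a ] ⊎ (∀ ψ (r : ψ ∈ Res T φ) → A ⊨ χ ψ r [ a ]))

{-# OPTIONS --safe #-}

-- If no resolvent of ψ holds at a in A, then by compactness a continues to a
-- realisation of ψ in some model of T receiving a homomorphism from A. Hence
-- if neither φ nor any resolvent of φ holds at a, and some ψ ∈ Res φ has no
-- resolvent holding at a, then A continues into a model of φ(a) and into one
-- of ψ(a), and these cannot be amalgamated. Conversely, if B and C cannot be
-- amalgamated over A, compactness gives φ and ψ ∈ Res φ with B ⊨ φ(a) and
-- C ⊨ ψ(a) for a tuple a of A; then A ⊭ φ(a), while a resolvent of φ or of ψ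
-- holding at a would be carried into B or C.
--
-- Compactness comes from ultraproducts indexed by finite parts of positive
-- atomic diagrams, by Łoś's theorem. Equality in an ultraproduct is equality
-- on a large set, so no quotient is taken. ExcludedMiddle decides arbitrary
-- types, not only propositions, and therefore also serves as the axiom of
-- choice.

module Submission where

open import Defs
open import Axiom.ExcludedMiddle using (ExcludedMiddle)
open import Axiom.Extensionality.Propositional using (Extensionality)
open import Data.Bool.Base using (Bool; true; false) renaming (T to IsTrue)
open import Data.Empty using (⊥-elim)
import Data.Empty.Polymorphic as Empty
open import Data.Fin.Base using (Fin; zero; suc; splitAt; _↑ˡ_; _↑ʳ_)
open import Data.List.Base
  using (List; []; _∷_; _++_; length; map; tabulate; concatMap; lookup)
open import Data.List.Membership.Propositional using () renaming (_∈_ to _∈ˡ_)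
open import Data.List.Membership.Propositional.Properties
  using (∈-++⁺ˡ; ∈-++⁺ʳ; ∈-tabulate⁺; ∈-concat⁺′; ∈-map⁺)
open import Data.List.Relation.Binary.Subset.Propositional
  using () renaming (_⊆_ to _⊆ˡ_)
open import Data.List.Relation.Binary.Subset.Propositional.Properties
  using (⊆-refl; ⊆-trans; xs⊆xs++ys; xs⊆ys++xs)
open import Data.List.Relation.Unary.All using (All; []; _∷_)
  renaming (map to mapAll; lookup to lookupAll; tabulate to tabulateAll)
open import Data.List.Relation.Unary.All.Properties
  using (map⁺; map⁻; tabulate⁺; tabulate⁻; ++⁺; ++⁻)
open import Data.List.Relation.Unary.Any using (here; index)
open import Data.List.Relation.Unary.Any.Properties using (lookup-index)
open import Data.Nat.Base using (ℕ; zero; suc; _+_)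
open import Data.Product.Base using (Σ-syntax; ∃-syntax; ∃; _×_; _,_; proj₁; proj₂)
open import Data.Sum.Base using (_⊎_; inj₁; inj₂; [_,_]′)
open import Data.Sum.Properties using ([,]-map)
open import Data.Vec.Functional using (Vector)
  renaming ([] to []ᵛ; _∷_ to _∷ᵛ_; _++_ to _++ᵛ_; head to headᵛ; tail to tailᵛ)
open import Data.Vec.Functional.Properties using (lookup-++ˡ; lookup-++ʳ)
open import Data.Vec.Functional.Relation.Binary.Pointwise using (Pointwise)
open import Function.Base using (_∘_; id)
open import Function.Bundles using (_⇔_; mk⇔; Equivalence)
open import Level using (Lift; lift) renaming (suc to lsuc)
open import Relation.Binary.PropositionalEquality
  using (_≡_; refl; sym; trans; cong; cong₂; subst)
open import Relation.Nullary using (¬_; Dec; yes; no; contradiction)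
open import Relation.Nullary.Decidable
  using (⌊_⌋; toWitness; fromWitness; decidable-stable)
open import Relation.Unary using (Pred)

module Classical (em : ∀ ℓ → ExcludedMiddle ℓ)
                 (ext : ∀ a b → Extensionality a b) where

  -- Classical logic and subsets.

  byContradiction : ∀ {p} {P : Set p} → ¬ ¬ P → P
  byContradiction = decidable-stable (em _)

  -- Subsets are Bool-valued so that the subsets of X live in the universe
  -- of X; this makes unions over all members of the tower below possible.
  Subset : ∀ {a} → Set a → Set a
  Subset X = X → Bool

  module _ {a} {X : Set a} where

    infix 4 _∈_ _⊆_

    _∈_ : X → Subset X → Set
    x ∈ S = IsTrue (S x)

    _⊆_ : Subset X → Subset X → Set a
    R ⊆ S = ∀ x → x ∈ R → x ∈ S

    -- Excluded middle acts as resizing: a predicate of any level `p` becomes a subset whose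
    -- membership lies in `Set`.
    ⟪_⟫ : ∀ {p} → Pred X p → Subset X
    ⟪ P ⟫ x = ⌊ em _ {P x} ⌋

    ∈⟪⟫⁺ : ∀ {p} (P : Pred X p) {x} → P x → x ∈ ⟪ P ⟫
    ∈⟪⟫⁺ P = fromWitness

    ∈⟪⟫⁻ : ∀ {p} (P : Pred X p) {x} → x ∈ ⟪ P ⟫ → P x
    ∈⟪⟫⁻ P = toWitness

    ⊆-antisym : ∀ {R S} → R ⊆ S → S ⊆ R → R ≡ S
    ⊆-antisym R⊆S S⊆R = ext _ _ λ x → agree (R⊆S x) (S⊆R x)
      where
      agree : ∀ {b c} → (IsTrue b → IsTrue c) → (IsTrue c → IsTrue b) → b ≡ c
      agree {false} {false} f g = refl
      agree {false} {true}  f g = ⊥-elim (g _)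
      agree {true}  {false} f g = ⊥-elim (f _)
      agree {true}  {true}  f g = refl

  -- Towers of subsets

  module Tower {a} {X : Set a} (base : Subset X) (next : Subset X → Subset X)
               (inflationary : ∀ S → S ⊆ next S) where

    -- Including `base` makes the union of the empty family equal to `base`, so that `Stage` needs
    -- no separate constructor for the bottom of the tower.
    InUnion : Subset (Subset X) → Pred X a
    InUnion C x = x ∈ base ⊎ ∃[ S ] S ∈ C × x ∈ S

    ⋃ : Subset (Subset X) → Subset X
    ⋃ C = ⟪ InUnion C ⟫

    -- Zermelo's tower: the least family closed under `next` and under unions. It serves in place of
    -- Zorn's lemma.
    data Stage : Subset X → Set a where
      step  : ∀ {S} → Stage S → Stage (next S)
      union : ∀ C → (∀ S → S ∈ C → Stage S) → Stage (⋃ C)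

    ⋃-upper : ∀ C {S} → S ∈ C → S ⊆ ⋃ C
    ⋃-upper C S∈C x x∈S = ∈⟪⟫⁺ (InUnion C) (inj₂ (_ , S∈C , x∈S))

    ⋃-least : ∀ C {R} → base ⊆ R → (∀ S → S ∈ C → S ⊆ R) → ⋃ C ⊆ R
    ⋃-least C b⊆R C⊆R x x∈⋃ with ∈⟪⟫⁻ (InUnion C) x∈⋃
    ... | inj₁ x∈b             = b⊆R x x∈b
    ... | inj₂ (S , S∈C , x∈S) = C⊆R S S∈C x x∈S

    base⊆ : ∀ {S} → Stage S → base ⊆ S
    base⊆ (step {S} s) x = inflationary S x ∘ base⊆ s x
    base⊆ (union C s)  x = ∈⟪⟫⁺ (InUnion C) ∘ inj₁

    ⋃-compare : ∀ C {R R′} → base ⊆ R → (∀ S → S ∈ C → S ⊆ R ⊎ R′ ⊆ S) →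
                ⋃ C ⊆ R ⊎ R′ ⊆ ⋃ C
    ⋃-compare C {R} {R′} b⊆R cmp with em _ {∃[ S ] S ∈ C × R′ ⊆ S}
    ... | yes (S , S∈C , R′⊆S) = inj₂ λ x → ⋃-upper C S∈C x ∘ R′⊆S x
    ... | no none = inj₁ (⋃-least C b⊆R λ S S∈C →
            [ id , (λ R′⊆S → contradiction (S , S∈C , R′⊆S) none) ]′ (cmp S S∈C))

    -- Inner half of Zermelo's double induction, on `S` with `R` fixed: once `R` is comparable with
    -- every stage, no stage lies strictly between `R` and `next R`.
    compare-next : ∀ {R} → Stage R → (∀ {S} → Stage S → R ⊆ S ⊎ next S ⊆ R) →
                   ∀ {S} → Stage S → S ⊆ R ⊎ next R ⊆ S
    compare-next r cmp (union C s) =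
      ⋃-compare C (base⊆ r) λ S S∈C → compare-next r cmp (s S S∈C)
    compare-next r cmp (step {S} s) with compare-next r cmp s | cmp s
    ... | inj₂ nR⊆S | _          = inj₂ λ x → inflationary S x ∘ nR⊆S x
    ... | inj₁ _    | inj₂ nS⊆R  = inj₁ nS⊆R
    ... | inj₁ S⊆R  | inj₁ R⊆S with ⊆-antisym R⊆S S⊆R
    ... | refl = inj₂ λ _ → id

    -- Outer induction, on `R`. In the successor case the induction hypothesis for `R` is what
    -- `compare-next` requires.
    compare : ∀ {R} → Stage R → ∀ {S} → Stage S → R ⊆ S ⊎ next S ⊆ R
    compare (union C r) s = ⋃-compare C (base⊆ s) λ R R∈C → compare (r R R∈C) s
    compare (step {R} r) s with compare r s | compare-next r (compare r) s
    ... | inj₂ nS⊆R | _         = inj₂ λ x → inflationary R x ∘ nS⊆R x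
    ... | inj₁ _    | inj₂ nR⊆S = inj₁ nR⊆S
    ... | inj₁ R⊆S  | inj₁ S⊆R with ⊆-antisym R⊆S S⊆R
    ... | refl = inj₂ λ _ → id

    chain : ∀ {R S} → Stage R → Stage S → R ⊆ S ⊎ S ⊆ R
    chain r s with compare r s
    ... | inj₁ R⊆S  = inj₁ R⊆S
    ... | inj₂ nS⊆R = inj₂ λ x → nS⊆R x ∘ inflationary _ x

    top : Subset X
    top = ⋃ ⟪ Stage ⟫

    top-stage : Stage top
    top-stage = union ⟪ Stage ⟫ λ S → ∈⟪⟫⁻ Stage

    -- The union of all stages is itself a stage, hence so is its successor, which is thus one of
    -- the sets united.
    next-top⊆top : next top ⊆ top
    next-top⊆top = ⋃-upper ⟪ Stage ⟫ (∈⟪⟫⁺ Stage (step top-stage))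

  -- Filters and ultrafilters

  module _ {ℓ} {I : Set ℓ} where

    record IsFilter (F : Subset (Pred I ℓ)) : Set (lsuc ℓ) where
      field
        whole  : ∀ {P} → (∀ i → P i) → P ∈ F
        upward : ∀ {P Q} → (∀ i → P i → Q i) → P ∈ F → Q ∈ F
        meet   : ∀ {P Q} → P ∈ F → Q ∈ F → (λ i → P i × Q i) ∈ F
        proper : ∀ {P} → P ∈ F → ∃ P

    record IsUltrafilter (F : Subset (Pred I ℓ)) : Set (lsuc ℓ) where
      field
        isFilter : IsFilter F
        prime    : ∀ {P} → ¬ (P ∈ F) → (λ i → ¬ P i) ∈ F
      open IsFilter isFilter public

    Compatible : Subset (Pred I ℓ) → Pred I ℓ → Set (lsuc ℓ)
    Compatible F P = ∀ Q → Q ∈ F → ∃[ i ] Q i × P i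

    Adjoined : Subset (Pred I ℓ) → Pred I ℓ → Pred (Pred I ℓ) (lsuc ℓ)
    Adjoined F P Q = ∃[ R ] R ∈ F × (∀ i → R i × P i → Q i)

    adjoin-isFilter : ∀ {F P} → IsFilter F → Compatible F P →
                      IsFilter ⟪ Adjoined F P ⟫
    adjoin-isFilter {F} {P} filter compatible = record
      { whole  = λ all → ∈⟪⟫⁺ (Adjoined F P) (_ , whole all , λ _ → proj₁)
      ; upward = λ Q⊆Q′ Q∈ → let (R , R∈F , R∩P⊆Q) = ∈⟪⟫⁻ (Adjoined F P) Q∈ in
          ∈⟪⟫⁺ (Adjoined F P) (R , R∈F , λ i → Q⊆Q′ i ∘ R∩P⊆Q i)
      ; meet   = λ Q∈ Q′∈ →
          let (R  , R∈F  , R∩P⊆Q)   = ∈⟪⟫⁻ (Adjoined F P) Q∈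
              (R′ , R′∈F , R′∩P⊆Q′) = ∈⟪⟫⁻ (Adjoined F P) Q′∈
          in ∈⟪⟫⁺ (Adjoined F P)
               (_ , meet R∈F R′∈F ,
                λ i ((r , r′) , p) → R∩P⊆Q i (r , p) , R′∩P⊆Q′ i (r′ , p))
      ; proper = λ Q∈ → let (R , R∈F , R∩P⊆Q) = ∈⟪⟫⁻ (Adjoined F P) Q∈
                            (i , r∧p) = compatible R R∈F
                        in i , R∩P⊆Q i r∧p
      }
      where open IsFilter filter

    -- The tower climbs from `F₀` by adjoining a compatible set not yet present whenever one exists.
    -- Its top is closed under `next`, so nothing can be adjoined there, and this maximality yields
    -- primeness.
    ultrafilter : ∀ {F₀ : Subset (Pred I ℓ)} → IsFilter F₀ →
                  Σ[ F ∈ Subset (Pred I ℓ) ] F₀ ⊆ F × IsUltrafilter F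
    ultrafilter {F₀} filter₀ = top , base⊆ top-stage , record
      { isFilter = stage-isFilter top-stage
      ; prime    = prime
      }
      where
      Extensible : Subset (Pred I ℓ) → Set (lsuc ℓ)
      Extensible F = ∃[ P ] ¬ (P ∈ F) × Compatible F P

      -- The decision is an argument so that later lemmas can match on it. The set to adjoin is the
      -- one that `em` returns, which is where choice enters.
      extend : ∀ F → Dec (Extensible F) → Subset (Pred I ℓ)
      extend F (yes (P , _)) = ⟪ Adjoined F P ⟫
      extend F (no _)        = F

      extend-⊆ : ∀ F d → F ⊆ extend F d
      extend-⊆ F (yes (P , _)) Q Q∈F = ∈⟪⟫⁺ (Adjoined F P) (Q , Q∈F , λ _ → proj₁)
      extend-⊆ F (no _)        Q Q∈F = Q∈F

      open Tower F₀ (λ F → extend F (em _)) (λ F → extend-⊆ F (em _))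

      extend-isFilter : ∀ {F} d → IsFilter F → IsFilter (extend F d)
      extend-isFilter (yes (P , _ , c)) f = adjoin-isFilter f c
      extend-isFilter (no _)            f = f

      stage-isFilter : ∀ {F} → Stage F → IsFilter F
      stage-isFilter (step s)    = extend-isFilter (em _) (stage-isFilter s)
      stage-isFilter (union C s) = record
        { whole  = λ all → base⊆ (union C s) _ (IsFilter.whole filter₀ all)
        ; upward = λ P⊆Q P∈ → upward P⊆Q (∈⟪⟫⁻ (InUnion C) P∈)
        ; meet   = λ P∈ Q∈ → meet (∈⟪⟫⁻ (InUnion C) P∈) (∈⟪⟫⁻ (InUnion C) Q∈)
        ; proper = λ P∈ → proper (∈⟪⟫⁻ (InUnion C) P∈)
        }
        where
        filter : ∀ S → S ∈ C → IsFilter S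
        filter S S∈C = stage-isFilter (s S S∈C)

        upward : ∀ {P Q} → (∀ i → P i → Q i) → InUnion C P → Q ∈ ⋃ C
        upward P⊆Q (inj₁ P∈) =
          base⊆ (union C s) _ (IsFilter.upward filter₀ P⊆Q P∈)
        upward P⊆Q (inj₂ (S , S∈C , P∈)) =
          ⋃-upper C S∈C _ (IsFilter.upward (filter S S∈C) P⊆Q P∈)

        meetIn : ∀ {P Q} S → S ∈ C → P ∈ S → Q ∈ S → (λ i → P i × Q i) ∈ ⋃ C
        meetIn S S∈C P∈ Q∈ = ⋃-upper C S∈C _ (IsFilter.meet (filter S S∈C) P∈ Q∈)

        meet : ∀ {P Q} → InUnion C P → InUnion C Q → (λ i → P i × Q i) ∈ ⋃ C
        meet (inj₁ P∈) (inj₁ Q∈) =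
          base⊆ (union C s) _ (IsFilter.meet filter₀ P∈ Q∈)
        meet (inj₁ P∈) (inj₂ (S , S∈C , Q∈)) = meetIn S S∈C (base⊆ (s S S∈C) _ P∈) Q∈
        meet (inj₂ (S , S∈C , P∈)) (inj₁ Q∈) = meetIn S S∈C P∈ (base⊆ (s S S∈C) _ Q∈)
        -- Stages form a chain, so both sets already belong to the larger of the two filters.
        meet (inj₂ (R , R∈C , P∈)) (inj₂ (S , S∈C , Q∈)) with chain (s R R∈C) (s S S∈C)
        ... | inj₁ R⊆S = meetIn S S∈C (R⊆S _ P∈) Q∈
        ... | inj₂ S⊆R = meetIn R R∈C P∈ (S⊆R _ Q∈)

        proper : ∀ {P} → InUnion C P → ∃ P
        proper (inj₁ P∈)             = IsFilter.proper filter₀ P∈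
        proper (inj₂ (S , S∈C , P∈)) = IsFilter.proper (filter S S∈C) P∈

      open IsFilter (stage-isFilter top-stage) using (whole; upward)

      maximal : ∀ d → extend top d ⊆ top → ¬ Extensible top
      maximal (yes (P , P∉ , _)) next⊆ _ = P∉ (next⊆ P
        -- The predicate `i ≡ i` is the whole of `I`, expressed at level `ℓ`.
        (∈⟪⟫⁺ (Adjoined top P) (_ , whole {λ i → i ≡ i} (λ _ → refl) , λ _ → proj₂)))
      maximal (no none)          _       = none

      prime : ∀ {P} → ¬ (P ∈ top) → (λ i → ¬ P i) ∈ top
      prime {P} P∉ = byContradiction λ ¬P∉ → maximal (em _) next-top⊆top
        -- `P` is compatible with `top`: a member `Q` disjoint from `P` would lie inside the
        -- complement of `P` and put that complement into `top`.
        (P , P∉ , λ Q Q∈ → byContradiction λ none →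
          ¬P∉ (upward (λ i q p → none (i , q , p)) Q∈))

  -- Ultraproducts

  []-unique : ∀ {a} {A : Set a} (xs : Vector A 0) → []ᵛ ≡ xs
  []-unique xs = ext _ _ λ ()

  ∷-η : ∀ {a} {A : Set a} {n} (xs : Vector A (suc n)) → headᵛ xs ∷ᵛ tailᵛ xs ≡ xs
  ∷-η xs = ext _ _ λ { zero → refl ; (suc i) → refl }

  module Ultraproduct {ℓ} {L : Language ℓ} {I : Set ℓ} {F : Subset (Pred I ℓ)}
                      (U : IsUltrafilter F) (M : I → Structure L) where
    open IsUltrafilter U
    open Language L
    private module M i = Structure (M i)

    -- Lifted because the relations of a structure over `L` take values in `Set ℓ`.
    Large : Pred I ℓ → Set ℓ
    Large P = Lift ℓ (P ∈ F)

    mono : ∀ {P Q : Pred I ℓ} → (∀ i → P i → Q i) → Large P → Large Q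
    mono P⊆Q (lift P∈) = lift (upward P⊆Q P∈)

    mono₂ : ∀ {P Q R : Pred I ℓ} → (∀ i → P i → Q i → R i) →
            Large P → Large Q → Large R
    mono₂ f (lift P∈) (lift Q∈) = lift (upward (λ i (p , q) → f i p q) (meet P∈ Q∈))

    ¬Large : ∀ {P} → ¬ Large P → Large (λ i → ¬ P i)
    ¬Large ¬P = lift (prime (¬P ∘ lift))

    inhabited : ∀ {P} → Large P → ∃ P
    inhabited (lift P∈) = proper P∈

    large-∀ : ∀ {k} {P : Fin k → Pred I ℓ} → (∀ j → Large (P j)) →
              Large (λ i → ∀ j → P j i)
    large-∀ {zero}  all = lift (whole λ i ())
    large-∀ {suc k} all =
      mono₂ (λ i p ps → λ { zero → p ; (suc j) → ps j }) (all zero) (large-∀ (all ∘ suc))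

    D : Structure L
    D = record
      { setoid = record
          { Carrier       = ∀ i → M.Carrier i
          ; _≈_           = λ x y → Large λ i → M._≈_ i (x i) (y i)
          ; isEquivalence = record
              { refl  = lift (whole λ i → M.refl i)
              ; sym   = mono λ i → M.sym i
              ; trans = mono₂ λ i → M.trans i
              }
          }
      ; inhabitant = M.inhabitant
      ; fun        = λ f xs i → M.fun i f λ j → xs j i
      ; fun-cong   = λ f eqs → mono (λ i → M.fun-cong i f) (large-∀ eqs)
      ; holds      = λ R xs → Large λ i → M.holds i R λ j → xs j i
      ; holds-resp = λ R eqs → mono₂ (λ i → M.holds-resp i R) (large-∀ eqs)
      }

    infix 6 _at_

    _at_ : ∀ {n} → Vector ∣ D ∣ n → ∀ i → Vector ∣ M i ∣ n
    (a at i) j = a j i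

    term-at : ∀ {n} (t : Term L n) a i → ⟦ t ⟧ D a i ≡ ⟦ t ⟧ (M i) (a at i)
    term-at (var j)    a i = refl
    term-at (app f ts) a i = cong (M.fun i f) (ext _ _ λ j → term-at (ts j) a i)

    ∷-at : ∀ {n} (x : ∣ D ∣) (a : Vector ∣ D ∣ n) i → (x ∷ᵛ a) at i ≡ x i ∷ᵛ a at i
    ∷-at x a i = sym (∷-η ((x ∷ᵛ a) at i))

    -- Induction on the formula, with both directions at once because implication reverses the
    -- direction on its left. Primeness of the ultrafilter enters at `∨`, `⇒` and `∀′`; properness
    -- settles `⊥`.
    Łoś : ∀ {n} (φ : Formula L n) a → D ⊨ φ [ a ] ⇔ Large (λ i → M i ⊨ φ [ a at i ])

    Łoś⁺ : ∀ {n} (φ : Formula L n) a → D ⊨ φ [ a ] → Large (λ i → M i ⊨ φ [ a at i ])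
    Łoś⁺ φ a = Equivalence.to (Łoś φ a)

    Łoś⁻ : ∀ {n} (φ : Formula L n) a → Large (λ i → M i ⊨ φ [ a at i ]) → D ⊨ φ [ a ]
    Łoś⁻ φ a = Equivalence.from (Łoś φ a)

    Łoś ⊥ a = mk⇔ (λ ()) λ large → proj₂ (inhabited large)
    Łoś (t ≐ u) a = mk⇔ (mono λ i → subst id (agree i)) (mono λ i → subst id (sym (agree i)))
      where
      agree : ∀ i → M._≈_ i (⟦ t ⟧ D a i) (⟦ u ⟧ D a i) ≡
                    M._≈_ i (⟦ t ⟧ (M i) (a at i)) (⟦ u ⟧ (M i) (a at i))
      agree i = cong₂ (M._≈_ i) (term-at t a i) (term-at u a i)
    Łoś (rel R ts) a = mk⇔ (mono λ i → subst id (agree i)) (mono λ i → subst id (sym (agree i)))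
      where
      agree : ∀ i → M.holds i R (λ j → ⟦ ts j ⟧ D a i) ≡
                    M.holds i R (λ j → ⟦ ts j ⟧ (M i) (a at i))
      agree i = cong (M.holds i R) (ext _ _ λ j → term-at (ts j) a i)
    Łoś (φ ∧ ψ) a = mk⇔
      (λ (p , q) → mono₂ (λ _ → _,_) (Łoś⁺ φ a p) (Łoś⁺ ψ a q))
      (λ pq → Łoś⁻ φ a (mono (λ _ → proj₁) pq) , Łoś⁻ ψ a (mono (λ _ → proj₂) pq))
    Łoś (φ ∨ ψ) a = mk⇔
      [ mono (λ _ → inj₁) ∘ Łoś⁺ φ a , mono (λ _ → inj₂) ∘ Łoś⁺ ψ a ]′
      (λ large → split large (em _))
      where
      split : Large (λ i → M i ⊨ φ ∨ ψ [ a at i ]) →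
              Dec (Large λ i → M i ⊨ φ [ a at i ]) → D ⊨ φ ∨ ψ [ a ]
      split large (yes p) = inj₁ (Łoś⁻ φ a p)
      split large (no ¬p) = inj₂ (Łoś⁻ ψ a
        (mono₂ (λ i p∨q ¬p → [ (λ p → contradiction p ¬p) , id ]′ p∨q) large (¬Large ¬p)))
    Łoś (φ ⇒ ψ) a = mk⇔ (λ f → split f (em _))
      (λ large p → Łoś⁻ ψ a (mono₂ (λ _ → id) large (Łoś⁺ φ a p)))
      where
      split : (D ⊨ φ [ a ] → D ⊨ ψ [ a ]) → Dec (Large λ i → M i ⊨ φ [ a at i ]) →
              Large (λ i → M i ⊨ φ ⇒ ψ [ a at i ])
      split f (yes p) = mono (λ i q _ → q) (Łoś⁺ ψ a (f (Łoś⁻ φ a p)))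
      split f (no ¬p) = mono (λ i ¬p p → contradiction p ¬p) (¬Large ¬p)
    Łoś (∃′ φ) a = mk⇔
      (λ (x , p) → mono (λ i q → x i , subst (M i ⊨ φ [_]) (∷-at x a i) q)
                        (Łoś⁺ φ (x ∷ᵛ a) p))
      (λ large → let x = λ i → witness i (em _) in
        x , Łoś⁻ φ (x ∷ᵛ a) (mono (λ i e →
          subst (M i ⊨ φ [_]) (sym (∷-at x a i)) (witnesses i (em _) e)) large))
      where
      witness : ∀ i → Dec (M i ⊨ ∃′ φ [ a at i ]) → ∣ M i ∣
      witness i (yes (x , _)) = x
      -- An arbitrary value: such indices lie outside the large set on which the existential formula
      -- holds.
      witness i (no _)        = M.inhabitant i

      witnesses : ∀ i d → M i ⊨ ∃′ φ [ a at i ] → M i ⊨ φ [ witness i d ∷ᵛ a at i ]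
      witnesses i (yes (_ , p)) _ = p
      witnesses i (no none)     e = contradiction e none
    Łoś (∀′ φ) a = mk⇔
      -- Pick a counterexample at every index that has one. If the universal formula failed on a
      -- large set, that set would meet the large set where `φ` holds of the chosen family, a
      -- contradiction at a common index.
      (λ all → byContradiction λ ¬large →
        let x = λ i → witness i (em _)
            (i , p , ¬all) = inhabited (mono₂ (λ _ → _,_) (Łoś⁺ φ (x ∷ᵛ a) (all x)) (¬Large ¬large))
        in witnesses i (em _) ¬all (subst (M i ⊨ φ [_]) (∷-at x a i) p))
      (λ large x → Łoś⁻ φ (x ∷ᵛ a) (mono (λ i all →
          subst (M i ⊨ φ [_]) (sym (∷-at x a i)) (all (x i))) large))
      where
      Counterexample : I → Set ℓ
      Counterexample i = Σ[ x ∈ ∣ M i ∣ ] ¬ (M i ⊨ φ [ x ∷ᵛ a at i ])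

      witness : ∀ i → Dec (Counterexample i) → ∣ M i ∣
      witness i (yes (x , _)) = x
      witness i (no _)        = M.inhabitant i

      witnesses : ∀ i d → ¬ (M i ⊨ ∀′ φ [ a at i ]) →
                  ¬ (M i ⊨ φ [ witness i d ∷ᵛ a at i ])
      witnesses i (yes (_ , ¬p)) _    = ¬p
      witnesses i (no none)      ¬all =
        contradiction (λ x → byContradiction λ ¬p → none (x , ¬p)) ¬all

  -- Limits of models along directed index sets.

  record Directed {ℓ} {I : Set ℓ} (_≤_ : I → I → Set ℓ) : Set ℓ where
    field
      point   : I
      ≤-refl  : ∀ {i} → i ≤ i
      ≤-trans : ∀ {i j k} → i ≤ j → j ≤ k → i ≤ k
      bound   : ∀ i j → ∃[ k ] i ≤ k × j ≤ k

  module _ {ℓ} {I : Set ℓ} {_≤_ : I → I → Set ℓ} (directed : Directed _≤_) where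
    open Directed directed

    Eventually : Pred (Pred I ℓ) ℓ
    Eventually P = ∃[ i ] ∀ j → i ≤ j → P j

    eventually-isFilter : IsFilter ⟪ Eventually ⟫
    eventually-isFilter = record
      { whole  = λ all → ∈⟪⟫⁺ Eventually (point , λ i _ → all i)
      ; upward = λ P⊆Q P∈ → let (i , p) = ∈⟪⟫⁻ Eventually P∈ in
          ∈⟪⟫⁺ Eventually (i , λ j → P⊆Q j ∘ p j)
      ; meet   = λ P∈ Q∈ →
          let (i , p) = ∈⟪⟫⁻ Eventually P∈
              (j , q) = ∈⟪⟫⁻ Eventually Q∈
              (k , i≤k , j≤k) = bound i j
          in ∈⟪⟫⁺ Eventually
               (k , λ l k≤l → p l (≤-trans i≤k k≤l) , q l (≤-trans j≤k k≤l))
      ; proper = λ P∈ → let (i , p) = ∈⟪⟫⁻ Eventually P∈ in i , p i ≤-refl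
      }

    -- The ultrafilter extends the filter of sets containing a tail, so whatever holds from some
    -- index on holds on a large set. An element of the ultraproduct is a family, hence `lim` is the
    -- identity.
    limit : ∀ {L : Language ℓ} {T : Theory L} (M : I → Model T) →
            Σ[ (D , _) ∈ Model T ] Σ[ lim ∈ ((∀ i → ∣ proj₁ (M i) ∣) → ∣ D ∣) ]
              (∀ {n} (φ : Formula L n) (xs : Vector (∀ i → ∣ proj₁ (M i) ∣) n) →
               Eventually (λ i → proj₁ (M i) ⊨ φ [ (λ j → xs j i) ]) →
               D ⊨ φ [ lim ∘ xs ])
    limit {L} {T} M = (D , D⊨T) , id , λ φ xs p → Łoś⁻ φ xs (lift (F₀⊆F _ (∈⟪⟫⁺ Eventually p)))
      where
      F = proj₁ (ultrafilter eventually-isFilter)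
      F₀⊆F = proj₁ (proj₂ (ultrafilter eventually-isFilter))
      isUltrafilter : IsUltrafilter F
      isUltrafilter = proj₂ (proj₂ (ultrafilter eventually-isFilter))
      open Ultraproduct isUltrafilter (proj₁ ∘ M)
      D⊨T : ∀ σ → T σ → D ⊨ σ
      D⊨T σ σ∈T = Łoś⁻ σ []ᵛ (lift (IsUltrafilter.whole isUltrafilter λ i →
        subst (proj₁ (M i) ⊨ σ [_]) ([]-unique _) (proj₂ (M i) σ σ∈T)))

  -- Positive formulas, diagrams and amalgamation

  module _ {ℓ} {L : Language ℓ} where

    idHom : {A : Structure L} → Hom A A
    idHom = record { map = id ; preserves = λ _ _ → id }

    term-cong : ∀ (A : Structure L) {n} (t : Term L n) {a b} →
                Pointwise (Structure._≈_ A) a b →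
                Structure._≈_ A (⟦ t ⟧ A a) (⟦ t ⟧ A b)
    term-cong A (var i)    a≈b = a≈b i
    term-cong A (app f ts) a≈b = Structure.fun-cong A f λ j → term-cong A (ts j) a≈b

    atomic-cong : ∀ (A : Structure L) {n} {φ : Formula L n} → Atomic φ → ∀ {a b} →
                  Pointwise (Structure._≈_ A) a b → A ⊨ φ [ a ] → A ⊨ φ [ b ]
    atomic-cong A (t ≐ u)    a≈b t≈u =
      trans-≈ (sym-≈ (term-cong A t a≈b)) (trans-≈ t≈u (term-cong A u a≈b))
      where open Structure A renaming (sym to sym-≈; trans to trans-≈)
    atomic-cong A (rel R ts) a≈b =
      Structure.holds-resp A R λ j → term-cong A (ts j) a≈b

    -- Allowing any `b` equal to the image up to `≈` lets the induction pass under `∃′`, where the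
    -- extended valuations agree only pointwise. With `idHom` it also gives invariance of positive
    -- formulas under `≈`.
    hom-positive : ∀ {A B : Structure L} (h : Hom A B) {n} {φ : Formula L n} →
                   Positive φ → ∀ {a b} →
                   Pointwise (Structure._≈_ B) (Hom.map h ∘ a) b →
                   A ⊨ φ [ a ] → B ⊨ φ [ b ]
    hom-positive {B = B} h (atomic α) ha≈b p = atomic-cong B α ha≈b (Hom.preserves h α _ p)
    hom-positive h (φ ∧ ψ) ha≈b (p , q)  = hom-positive h φ ha≈b p , hom-positive h ψ ha≈b q
    hom-positive h (φ ∨ ψ) ha≈b (inj₁ p) = inj₁ (hom-positive h φ ha≈b p)
    hom-positive h (φ ∨ ψ) ha≈b (inj₂ q) = inj₂ (hom-positive h ψ ha≈b q)
    hom-positive {B = B} h (∃′ φ) ha≈b (x , p) = Hom.map h x , hom-positive h φ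
      (λ { zero → Structure.refl B ; (suc i) → ha≈b i }) p

    hom-positive′ : ∀ {A B : Structure L} (h : Hom A B) {n} {φ : Formula L n} →
                    Positive φ → ∀ a → A ⊨ φ [ a ] → B ⊨ φ [ Hom.map h ∘ a ]
    hom-positive′ {B = B} h φ a = hom-positive h φ λ i → Structure.refl B

    -- Renaming, finite conjunctions and quantifier blocks.

    rename : ∀ {m n} → (Fin m → Fin n) → Term L m → Term L n
    rename ρ (var i)    = var (ρ i)
    rename ρ (app f ts) = app f λ j → rename ρ (ts j)

    ⟦rename⟧ : ∀ {m n} (ρ : Fin m → Fin n) t (A : Structure L) a →
               ⟦ rename ρ t ⟧ A a ≡ ⟦ t ⟧ A (a ∘ ρ)
    ⟦rename⟧ ρ (var i)    A a = refl
    ⟦rename⟧ ρ (app f ts) A a =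
      cong (Structure.fun A f) (ext _ _ λ j → ⟦rename⟧ ρ (ts j) A a)

    rename-atomic : ∀ {m n} (ρ : Fin m → Fin n) {φ : Formula L m} → Atomic φ →
                    Σ[ ψ ∈ Formula L n ] Atomic ψ ×
                      (∀ A a → (A ⊨ ψ [ a ]) ≡ (A ⊨ φ [ a ∘ ρ ]))
    rename-atomic ρ ⊥ = ⊥ , ⊥ , λ A a → refl
    rename-atomic ρ (t ≐ u) = rename ρ t ≐ rename ρ u , (_ ≐ _) , λ A a →
      cong₂ (Structure._≈_ A) (⟦rename⟧ ρ t A a) (⟦rename⟧ ρ u A a)
    rename-atomic ρ (rel R ts) = rel R (λ j → rename ρ (ts j)) , rel R _ , λ A a →
      cong (Structure.holds A R) (ext _ _ λ j → ⟦rename⟧ ρ (ts j) A a)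

    -- A context with at least one variable: the empty conjunction has to be a
    -- positive formula, and x₀ ≐ x₀ serves as truth.
    ⋀ : ∀ {n} → List (Formula L (suc n)) → Formula L (suc n)
    ⋀ []       = var zero ≐ var zero
    ⋀ (φ ∷ φs) = φ ∧ ⋀ φs

    ⋀-positive : ∀ {n} {φs : List (Formula L (suc n))} → All Positive φs → Positive (⋀ φs)
    ⋀-positive []       = atomic (_ ≐ _)
    ⋀-positive (φ ∷ φs) = φ ∧ ⋀-positive φs

    ⋀⁺ : ∀ (A : Structure L) {n} {a} {φs : List (Formula L (suc n))} →
         All (λ φ → A ⊨ φ [ a ]) φs → A ⊨ ⋀ φs [ a ]
    ⋀⁺ A []       = Structure.refl A
    ⋀⁺ A (p ∷ ps) = p , ⋀⁺ A ps

    ⋀⁻ : ∀ (A : Structure L) {n} {a} (φs : List (Formula L (suc n))) →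
         A ⊨ ⋀ φs [ a ] → All (λ φ → A ⊨ φ [ a ]) φs
    ⋀⁻ A []       _        = []
    ⋀⁻ A (φ ∷ φs) (p , ps) = p ∷ ⋀⁻ A φs ps

    ∃^-positive : ∀ {m} k {φ : Formula L (k + m)} → Positive φ → Positive (∃^ k φ)
    ∃^-positive zero    φ = φ
    ∃^-positive (suc k) φ = ∃^-positive k (∃′ φ)

    ++-suc : ∀ {a} {X : Set a} {k m} (c : Vector X (suc k)) (w : Vector X m) →
             headᵛ c ∷ᵛ (tailᵛ c ++ᵛ w) ≡ c ++ᵛ w
    ++-suc {k = k} c w = ext _ _ λ where
      zero    → refl
      (suc i) → sym ([,]-map (splitAt k i))

    ∃^⁺ : ∀ (A : Structure L) {m} k {φ : Formula L (k + m)} c {w} →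
          A ⊨ φ [ c ++ᵛ w ] → A ⊨ ∃^ k φ [ w ]
    ∃^⁺ A zero            c p = p
    ∃^⁺ A (suc k) {φ} c {w} p =
      ∃^⁺ A k (tailᵛ c) (headᵛ c , subst (A ⊨ φ [_]) (sym (++-suc c w)) p)

    ∃^⁻ : ∀ (A : Structure L) {m} k {φ : Formula L (k + m)} {w} →
          A ⊨ ∃^ k φ [ w ] → ∃[ c ] A ⊨ φ [ c ++ᵛ w ]
    ∃^⁻ A zero            p = []ᵛ , p
    ∃^⁻ A (suc k) {φ} {w} p with ∃^⁻ A k p
    ... | c , x , q = x ∷ᵛ c , subst (A ⊨ φ [_]) (++-suc (x ∷ᵛ c) w) q

    ∃*⁺ : ∀ (A : Structure L) {n} (φ : Formula L n) w → A ⊨ φ [ w ] → A ⊨ ∃* φ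
    ∃*⁺ A {zero}  φ w p = subst (A ⊨ φ [_]) (sym ([]-unique w)) p
    ∃*⁺ A {suc n} φ w p =
      ∃*⁺ A (∃′ φ) (tailᵛ w) (headᵛ w , subst (A ⊨ φ [_]) (sym (∷-η w)) p)

    ∃*⁻ : ∀ (A : Structure L) {n} (φ : Formula L n) → A ⊨ ∃* φ → ∃[ w ] A ⊨ φ [ w ]
    ∃*⁻ A {zero}  φ p = []ᵛ , p
    ∃*⁻ A {suc n} φ p with ∃*⁻ A (∃′ φ) p
    ... | w , x , q = x ∷ᵛ w , q

    -- Resolvents.

    ⊥∈Res : ∀ (T : Theory L) {n} (φ : Formula L n) → Res T φ ⊥
    ⊥∈Res T φ = atomic ⊥ , λ (M , _) p → proj₂ (proj₂ (∃*⁻ M (φ ∧ ⊥) p))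

    resolvent-disjoint : ∀ {T : Theory L} ((M , _) : Model T) {n} {φ ψ : Formula L n} →
                         Res T φ ψ → ∀ w → M ⊨ φ [ w ] → ¬ (M ⊨ ψ [ w ])
    resolvent-disjoint M {φ = φ} {ψ} (_ , T⊢) w p q =
      Empty.⊥-elim (T⊢ M (∃*⁺ (proj₁ M) (φ ∧ ψ) w (p , q)))

    -- For positive `ψ`, failing to be a resolvent can only mean that the sentence `¬′ ∃* (φ ∧ ψ)`
    -- fails in some model of `T`.
    consistent : ∀ {T : Theory L} {n} {φ ψ : Formula L n} → Positive ψ → ¬ Res T φ ψ →
                 Σ[ (M , _) ∈ Model T ] ∃[ w ] M ⊨ φ [ w ] × M ⊨ ψ [ w ]
    consistent {φ = φ} {ψ} posψ ¬res = byContradiction λ none → ¬res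
      (posψ , λ M p → contradiction (M , ∃*⁻ (proj₁ M) (φ ∧ ψ) p) none)

    -- Finite parts of positive diagrams.

    module _ (A : Structure L) where

      -- A member of the positive atomic diagram of `A`. A valuation takes the place of new
      -- constants, so the language stays fixed.
      record Fact : Set ℓ where
        constructor fact
        field
          {arity}     : ℕ
          {statement} : Formula L arity
          isAtomic    : Atomic statement
          elements    : Vector ∣ A ∣ arity
          true-in-A   : A ⊨ statement [ elements ]
      open Fact

      FactIn : (M : Structure L) → (∣ A ∣ → ∣ M ∣) → Pred Fact ℓ
      FactIn M v F = M ⊨ statement F [ v ∘ elements F ]

      -- `χ` quantifies existentially over the elements that occur in `Δ` or `a`, and conjoins the
      -- facts with equations tying the bound variable of each `a j` to the free variable `j`. A
      -- realisation assigns values to the bound variables, and `v` reads them off through `pos`.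
      finite-diagram :
        ∀ (Δ : List Fact) {n} (a : Vector ∣ A ∣ n) →
        Σ[ χ ∈ Formula L n ] Positive χ × A ⊨ χ [ a ] ×
          (∀ M w → M ⊨ χ [ w ] → Σ[ v ∈ (∣ A ∣ → ∣ M ∣) ]
            All (FactIn M v) Δ × Pointwise (Structure._≈_ M) (v ∘ a) w)
      finite-diagram Δ {n} a = ∃^ m (⋀ conjuncts)
                             , ∃^-positive m (⋀-positive positive)
                             , ∃^⁺ A m t (⋀⁺ A (++⁺ facts-true names-true))
                             , realise
        where
        elems : List ∣ A ∣
        elems = concatMap (tabulate ∘ elements) Δ ++ tabulate a

        -- The extra head makes `m` a successor, as `⋀` requires, and gives elements outside the
        -- list the default position `zero`. It accounts for the `suc` in `position-correct`.
        elems⁺ : List ∣ A ∣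
        elems⁺ = Structure.inhabitant A ∷ elems

        m = length elems⁺

        t : Vector ∣ A ∣ m
        t = lookup elems⁺

        -- One fixed position for each element: a valuation of the m bound
        -- variables then induces a map on A even if t is not injective.
        position : ∀ x → Dec (∃[ i ] t i ≡ x) → Fin m
        position x (yes (i , _)) = i
        position x (no _)        = zero

        pos : ∣ A ∣ → Fin m
        pos x = position x (em _)

        position-correct : ∀ {x} d → x ∈ˡ elems → t (position x d) ≡ x
        position-correct (yes (_ , ti≡x)) _ = ti≡x
        position-correct (no none) x∈ =
          contradiction (suc (index x∈) , sym (lookup-index x∈)) none

        pos-elements : ∀ {F} → F ∈ˡ Δ → t ∘ pos ∘ elements F ≡ elements F
        pos-elements {F} F∈ = ext _ _ λ j → position-correct (em _)
          (∈-++⁺ˡ (∈-concat⁺′ (∈-tabulate⁺ {f = elements F} j) (∈-map⁺ (tabulate ∘ elements) F∈)))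

        pos-a : ∀ j → t (pos (a j)) ≡ a j
        pos-a j = position-correct (em _)
          (∈-++⁺ʳ (concatMap (tabulate ∘ elements) Δ) (∈-tabulate⁺ {f = a} j))

        renamed : (F : Fact) → _
        renamed F = rename-atomic (λ j → pos (elements F j) ↑ˡ n) (isAtomic F)

        name : Fin n → Formula L (m + n)
        name j = var (pos (a j) ↑ˡ n) ≐ var (m ↑ʳ j)

        conjuncts : List (Formula L (m + n))
        conjuncts = map (proj₁ ∘ renamed) Δ ++ tabulate name

        positive : All Positive conjuncts
        positive = ++⁺ (map⁺ {xs = Δ} (tabulateAll λ {F} _ → atomic (proj₁ (proj₂ (renamed F)))))
                       (tabulate⁺ {f = name} λ j → atomic (_ ≐ _))

        renamed-holds : ∀ M c w F →
          (M ⊨ proj₁ (renamed F) [ c ++ᵛ w ]) ≡ FactIn M (c ∘ pos) F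
        renamed-holds M c w F = trans (proj₂ (proj₂ (renamed F)) M (c ++ᵛ w))
          (cong (M ⊨ statement F [_]) (ext _ _ λ j → lookup-++ˡ c w (pos (elements F j))))

        name-holds : ∀ M c w j →
          (M ⊨ name j [ c ++ᵛ w ]) ≡ Structure._≈_ M (c (pos (a j))) (w j)
        name-holds M c w j =
          cong₂ (Structure._≈_ M) (lookup-++ˡ c w (pos (a j))) (lookup-++ʳ c w j)

        facts-true : All (λ φ → A ⊨ φ [ t ++ᵛ a ]) (map (proj₁ ∘ renamed) Δ)
        facts-true = map⁺ (tabulateAll λ {F} F∈ →
          subst id (sym (renamed-holds A t a F))
            (subst (A ⊨ statement F [_]) (sym (pos-elements F∈)) (true-in-A F)))

        names-true : All (λ φ → A ⊨ φ [ t ++ᵛ a ]) (tabulate name)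
        names-true = tabulate⁺ λ j → subst id (sym (name-holds A t a j))
          (Structure.reflexive A (pos-a j))

        realise : ∀ M w → M ⊨ ∃^ m (⋀ conjuncts) [ w ] → Σ[ v ∈ (∣ A ∣ → ∣ M ∣) ]
                  All (FactIn M v) Δ × Pointwise (Structure._≈_ M) (v ∘ a) w
        realise M w p with ∃^⁻ M m p
        ... | c , q with ++⁻ (map (proj₁ ∘ renamed) Δ) (⋀⁻ M conjuncts q)
        ... | facts , names = c ∘ pos
                            , mapAll (λ {F} → subst id (renamed-holds M c w F)) (map⁻ facts)
                            , λ j → subst id (name-holds M c w j) (tabulate⁻ names j)

    -- Continuations and amalgamation.

    list-directed : ∀ {X : Set ℓ} → Directed (_⊆ˡ_ {A = X})
    list-directed = record
      { point   = []
      ; ≤-refl  = ⊆-refl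
      ; ≤-trans = ⊆-trans
      ; bound   = λ xs ys → xs ++ ys , xs⊆xs++ys xs ys , xs⊆ys++xs ys xs
      }

    ×-directed : ∀ {I J : Set ℓ} {_≤₁_ : I → I → Set ℓ} {_≤₂_ : J → J → Set ℓ} →
                 Directed _≤₁_ → Directed _≤₂_ →
                 Directed (λ (i , j) (i′ , j′) → i ≤₁ i′ × j ≤₂ j′)
    ×-directed d₁ d₂ = record
      { point   = D₁.point , D₂.point
      ; ≤-refl  = D₁.≤-refl , D₂.≤-refl
      ; ≤-trans = λ (p , q) (p′ , q′) → D₁.≤-trans p p′ , D₂.≤-trans q q′
      ; bound   = λ (i , j) (i′ , j′) →
          let (k , p , p′) = D₁.bound i i′
              (l , q , q′) = D₂.bound j j′
          in (k , l) , (p , q) , (p′ , q′)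
      }
      where
      module D₁ = Directed d₁
      module D₂ = Directed d₂

    module _ (T : Theory L) (A : Model T) where
      private
        ∣A∣ = ∣ proj₁ A ∣

      NoResolventAt : ∀ {n} → Formula L n → Vector ∣A∣ n → Set (lsuc ℓ)
      NoResolventAt ψ a = ∀ χ → Res T ψ χ → ¬ (proj₁ A ⊨ χ [ a ])

      -- The diagram formula of each finite `Δ` holds at `a`, so by hypothesis it is not a resolvent
      -- of `ψ` and some model realises both. The limit of these models along all `Δ` receives `A`.
      continuation : ∀ {n} {ψ : Formula L n} → Positive ψ → ∀ a → NoResolventAt ψ a →
                     Σ[ (B , _) ∈ Model T ] Σ[ f ∈ Hom (proj₁ A) B ] B ⊨ ψ [ Hom.map f ∘ a ]
      continuation {ψ = ψ} posψ a noResolvent = B , f , B⊨ψ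
        where
        stage : ∀ Δ → Σ[ (M , _) ∈ Model T ] Σ[ v ∈ (∣A∣ → ∣ M ∣) ]
                        All (FactIn (proj₁ A) M v) Δ × M ⊨ ψ [ v ∘ a ]
        stage Δ =
          let (χ , posχ , A⊨χ , realise) = finite-diagram (proj₁ A) Δ a
              (M , w , M⊨ψ , M⊨χ) = consistent posχ λ res → noResolvent χ res A⊨χ
              (v , facts , va≈w) = realise (proj₁ M) w M⊨χ
          in M , v , facts ,
             -- Moves `ψ` from the realising tuple `w` to the images of `a`, which equal it up to
             -- `≈`.
             hom-positive idHom posψ (λ j → Structure.sym (proj₁ M) (va≈w j)) M⊨ψ

        v : ∀ Δ → ∣A∣ → ∣ proj₁ (proj₁ (stage Δ)) ∣
        v Δ = proj₁ (proj₂ (stage Δ))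

        lim = limit list-directed (proj₁ ∘ stage)
        B = proj₁ lim
        holds = proj₂ (proj₂ lim)

        f : Hom (proj₁ A) (proj₁ B)
        f = record
          { map       = λ x → proj₁ (proj₂ lim) λ Δ → v Δ x
          -- The fact holds at every stage whose list contains it, hence from its singleton list on.
          ; preserves = λ {_} {φ} α b p → holds φ (λ j Δ → v Δ (b j))
              (fact α b p ∷ [] , λ Δ ⊆Δ →
                lookupAll (proj₁ (proj₂ (proj₂ (stage Δ)))) (⊆Δ (here refl)))
          }

        B⊨ψ : proj₁ B ⊨ ψ [ Hom.map f ∘ a ]
        B⊨ψ = holds ψ (λ j Δ → v Δ (a j)) ([] , λ Δ _ → proj₂ (proj₂ (proj₂ (stage Δ))))

      amalgamation⇒resolvents : AmalgamationBasis T A → ResolventProperty T (proj₁ A)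
      amalgamation⇒resolvents amalgamate φ posφ a ¬φ
        with em _ {∃[ φ′ ] Res T φ φ′ × proj₁ A ⊨ φ′ [ a ]}
      ... | yes (φ′ , res , A⊨φ′) =
        -- Only the first disjunct is claimed, so the family may be constantly `⊥`, which is a
        -- resolvent of every formula.
        φ′ , res , (λ _ _ → ⊥) , (λ ψ _ → ⊥∈Res T ψ) , inj₁ A⊨φ′
      ... | no none = ⊥ , ⊥∈Res T φ , (λ ψ r → proj₁ (resolvent ψ r))
                    , (λ ψ r → proj₁ (proj₂ (resolvent ψ r)))
                    , inj₂ (λ ψ r → proj₂ (proj₂ (resolvent ψ r)))
        where
        resolvent : ∀ ψ → Res T φ ψ → ∃[ χ ] Res T ψ χ × proj₁ A ⊨ χ [ a ]
        -- Otherwise both `ψ` and `φ` are realised over `A`. In an amalgam the two images of `a`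
        -- agree up to `≈`, and there `φ` and `ψ` would hold together.
        resolvent ψ r = byContradiction λ noχ →
          let (B , f , B⊨ψ) = continuation (proj₁ r) a λ χ s p → noχ (χ , s , p)
              (C , g , C⊨φ) = continuation posφ a λ χ s p → none (χ , s , p)
              (D , f′ , g′ , commute) = amalgamate B C f g
          in resolvent-disjoint D r _
               (hom-positive′ g′ posφ _ C⊨φ)
               (hom-positive f′ (proj₁ r) (commute ∘ a) B⊨ψ)

      -- An index prescribes finitely many facts of `B`, finitely many facts of `C`, and finitely
      -- many elements of `A` on which the square has to commute. In the limit all these demands are
      -- met.
      resolvents⇒amalgamation : ResolventProperty T (proj₁ A) → AmalgamationBasis T A
      resolvents⇒amalgamation property B C f g = D , g′ , f′ , λ x →
        holds (var zero ≐ var (suc zero))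
          ((λ i → vB i (Hom.map f x)) ∷ᵛ (λ i → vC i (Hom.map g x)) ∷ᵛ []ᵛ)
          (([] , [] , x ∷ []) , λ i (_ , _ , ⊆xs) → commute i (⊆xs (here refl)))
        where
        Index : Set ℓ
        Index = List (Fact (proj₁ B)) × List (Fact (proj₁ C)) × List ∣A∣

        -- If both held, `φ` would fail at `a` in `A`, since `g` would carry it to `C` against `ψ`.
        -- The property then provides a resolvent of `φ`, which `f` carries to `B`, or one of `ψ`,
        -- which `g` carries to `C`; either is contradictory.
        disjoint : ∀ {n} {φ ψ : Formula L n} → Positive φ → Res T φ ψ → ∀ a →
                   proj₁ B ⊨ φ [ Hom.map f ∘ a ] → ¬ (proj₁ C ⊨ ψ [ Hom.map g ∘ a ])
        disjoint {φ = φ} {ψ} posφ r a B⊨φ C⊨ψ with property φ posφ a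
          (λ A⊨φ → resolvent-disjoint C r _ (hom-positive′ g posφ a A⊨φ) C⊨ψ)
        ... | φ′ , r′ , _ , _ , inj₁ A⊨φ′ =
          resolvent-disjoint B r′ _ B⊨φ (hom-positive′ f (proj₁ r′) a A⊨φ′)
        ... | _ , _ , χ , resχ , inj₂ A⊨χ =
          resolvent-disjoint C (resχ ψ r) _ C⊨ψ
            (hom-positive′ g (proj₁ (resχ ψ r)) a (A⊨χ ψ r))

        stage : ((Δ , Δ′ , xs) : Index) →
                Σ[ (M , _) ∈ Model T ]
                Σ[ v  ∈ (∣ proj₁ B ∣ → ∣ M ∣) ] Σ[ v′ ∈ (∣ proj₁ C ∣ → ∣ M ∣) ]
                  All (FactIn (proj₁ B) M v) Δ × All (FactIn (proj₁ C) M v′) Δ′ ×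
                  (∀ {x} → x ∈ˡ xs → Structure._≈_ M (v (Hom.map f x)) (v′ (Hom.map g x)))
        stage (Δ , Δ′ , xs) =
          let a = lookup xs
              (φ , posφ , B⊨φ , realise)  = finite-diagram (proj₁ B) Δ (Hom.map f ∘ a)
              (ψ , posψ , C⊨ψ , realise′) = finite-diagram (proj₁ C) Δ′ (Hom.map g ∘ a)
              -- The two diagram formulas share their free variables, one for each entry of `xs`. A
              -- single `w` therefore names both images of each entry and makes `v` and `v′` agree
              -- there.
              (M , w , M⊨φ , M⊨ψ) = consistent posψ λ r → disjoint posφ r a B⊨φ C⊨ψ
              (v  , facts  , v≈w)  = realise (proj₁ M) w M⊨φ
              (v′ , facts′ , v′≈w) = realise′ (proj₁ M) w M⊨ψ
          in M , v , v′ , facts , facts′ , λ {x} x∈ →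
             subst (λ x → Structure._≈_ (proj₁ M) (v (Hom.map f x)) (v′ (Hom.map g x)))
               (sym (lookup-index x∈))
               (Structure.trans (proj₁ M) (v≈w (index x∈))
                 (Structure.sym (proj₁ M) (v′≈w (index x∈))))

        vB : ∀ i → ∣ proj₁ B ∣ → ∣ proj₁ (proj₁ (stage i)) ∣
        vB i = proj₁ (proj₂ (stage i))

        vC : ∀ i → ∣ proj₁ C ∣ → ∣ proj₁ (proj₁ (stage i)) ∣
        vC i = proj₁ (proj₂ (proj₂ (stage i)))

        commute : ∀ (i@(_ , _ , xs) : Index) {x} → x ∈ˡ xs →
                  Structure._≈_ (proj₁ (proj₁ (stage i)))
                    (vB i (Hom.map f x)) (vC i (Hom.map g x))
        commute i = proj₂ (proj₂ (proj₂ (proj₂ (proj₂ (stage i)))))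

        lim = limit (×-directed list-directed (×-directed list-directed list-directed))
                    (proj₁ ∘ stage)
        D = proj₁ lim
        holds = proj₂ (proj₂ lim)

        g′ : Hom (proj₁ B) (proj₁ D)
        g′ = record
          { map       = λ x → proj₁ (proj₂ lim) λ i → vB i x
          ; preserves = λ {_} {φ} α b p → holds φ (λ j i → vB i (b j))
              ((fact α b p ∷ [] , [] , []) , λ i (⊆Δ , _) →
                lookupAll (proj₁ (proj₂ (proj₂ (proj₂ (stage i))))) (⊆Δ (here refl)))
          }

        f′ : Hom (proj₁ C) (proj₁ D)
        f′ = record
          { map       = λ x → proj₁ (proj₂ lim) λ i → vC i x
          ; preserves = λ {_} {φ} α c p → holds φ (λ j i → vC i (c j))
              (([] , fact α c p ∷ [] , []) , λ i (_ , ⊆Δ′ , _) →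
                lookupAll (proj₁ (proj₂ (proj₂ (proj₂ (proj₂ (stage i)))))) (⊆Δ′ (here refl)))
          }

theorem2 : (∀ ℓ → ExcludedMiddle ℓ) → (∀ a b → Extensionality a b) →
    ∀ {ℓ} (L : Language ℓ) (T : Theory L) → HInductiveTheory T →
    (A : Model T) →
    AmalgamationBasis T A ⇔ ResolventProperty T (proj₁ A)
theorem2 em ext L T _ A = mk⇔ (amalgamation⇒resolvents T A) (resolvents⇒amalgamation T A)
  where open Classical em ext
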